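{- Let $n>2$ be an integer and let $d_1<d_2<\cdots<d_D$ be all the positive proper divisors of $n$ (the divisors other than $1$ and $n$). Then the Szeged index of the power graph of the dihedral group $\mathrm{D}_n$ of order $2n$ is $$Sz(\mathcal{P}(\mathrm{D}_n))=Sz(\mathcal{P}(\mathbb{Z}_n^*))+\sum_{i=1}^{D}\Biggl(n+1+\sum_{\substack{1\le k\le D,\ k\ne i\\ d_k\nsim d_i}}\varphi(d_k)\Biggr)\varphi(d_i)+n\bigl(2n-1+\varphi(n)\bigr)+\varphi(n).$$
   Context: $\varphi$ is Euler's totient function. For distinct proper divisors $d_i,d_k$ of $n$, write $d_k\sim d_i$ if one of them divides the other, and $d_k\nsim d_i$ otherwise. Empty sums are $0$. The dihedral group of order $2n$ is $\mathrm{D}_n=\langle r,s: r^n=s^2=1,\ rs=sr^{ -1}\rangle$. The power graph $\mathcal{P}(G)$ of a finite group $G$ is the simple undirected graph with vertex set $G$ in which two distinct elements $u,v$ are adjacent iff $u=v^m$ or $v=u^m$ for some $m\in\mathbb{N}$ (in the additive cyclic group $\mathbb{Z}_n$ of order $n$: $u=mv$ or $v=mu$). Here $\mathbb{Z}_n^*=\mathbb{Z}_n\setminus\{0\}$ (all nonzero elements, not the unit group), and $\mathcal{P}(\mathbb{Z}_n^*)$ is the graph obtained from $\mathcal{P}(\mathbb{Z}_n)$ by deleting the vertex $0$ and all edges incident to it. For an edge $ab$ of a finite simple connected graph $H$ with distance function $d$, put $n_1(ab|H)=|\{x\in V(H): d(x,a)<d(x,b)\}|$ and $n_2(ab|H)=|\{x\in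 V(H): d(x,b)<d(x,a)\}|$. The Szeged index is $Sz(H)=\sum_{ab\in E(H)} n_1(ab|H)\,n_2(ab|H)$ (each undirected edge counted once). -}

module Defs where

open import Level using (0ℓ)
open import Algebra.Bundles using (AbelianGroup; Group)
import Algebra.Definitions.RawMonoid as RawMonoidDefinitions
import Algebra.Properties.AbelianGroup as AbelianGroupProperties
import Algebra.Properties.Group as GroupProperties
import Algebra.Properties.Monoid.Mult as MonoidMult
open import Data.Bool.Base using (if_then_else_)
open import Data.Fin.Base using (Fin; zero; suc; toℕ; fromℕ<; punchIn) renaming (_<_ to _<ᶠ_)
open import Data.Fin.Properties
  using (any?; pigeonhole; punchIn-injective; +↔⊎; toℕ-fromℕ<; toℕ-injective; toℕ<n)
  renaming (_≟_ to _≟ᶠ_; _<?_ to _<ᶠ?_)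
open import Data.Nat.Base
open import Data.Nat.Coprimality using (coprime?)
open import Data.Nat.Divisibility using (_∣_; _∣?_)
open import Data.Nat.DivMod
  using (_%_; _mod_; m%n<n; m%n%n≡m%n; m<n⇒m%n≡m; n%n≡0; %-distribˡ-+)
open import Data.Nat.Induction using (<-rec)
open import Data.Nat.Properties
open import Data.Product.Base using (∃; _×_; _,_; proj₁; proj₂)
open import Data.Sum.Base using (_⊎_; inj₁; inj₂; swap)
open import Function.Base using (_∘_)
open import Function.Bundles using (Inverse)
import Function.Construct.Identity as Identity
open import Relation.Binary.Core using (Rel)
open import Relation.Binary.Definitions using (Decidable; Irreflexive; Symmetric)
open import Relation.Binary.PropositionalEquality
  using (_≡_; _≢_; refl; sym; trans; cong; cong₂; subst; setoid; isEquivalence; module ≡-Reasoning)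
import Relation.Binary.Reasoning.Setoid as SetoidReasoning
open import Relation.Nullary.Decidable using (Dec; yes; no; does; ¬?; map′; _×-dec_; _⊎-dec_)
open import Relation.Nullary.Negation using (¬_; contradiction)
open import Relation.Unary using (Pred) renaming (Decidable to Decidable₁)

open import Algebra.Properties.CommutativeMonoid.Sum +-0-commutativeMonoid public
  using (sum-syntax)

sumOver : ∀ {n p} {P : Pred (Fin n) p} → Decidable₁ P → (Fin n → ℕ) → ℕ
sumOver {n} P? f = ∑[ i < n ] (if does (P? i) then f i else 0)

count : ∀ {n p} {P : Pred (Fin n) p} → Decidable₁ P → ℕ
count P? = sumOver P? (λ _ → 1)

φ : ℕ → ℕ
φ n = count {n} (λ k → coprime? (suc (toℕ k)) n)

ProperDivisor : ℕ → ℕ → Set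
ProperDivisor d n = d ∣ n × d ≢ 1 × d ≢ n

infix 4 _∼_ _∼?_

_∼_ : Rel ℕ 0ℓ
d ∼ e = d ∣ e ⊎ e ∣ d

_∼?_ : Decidable _∼_
d ∼? e = (d ∣? e) ⊎-dec (e ∣? d)

record Graph (n : ℕ) : Set₁ where
  infix 4 _~_ _~?_
  field
    _~_      : Rel (Fin n) 0ℓ
    _~?_     : Decidable _~_
    ~-sym    : Symmetric _~_
    ~-irrefl : Irreflexive _≡_ _~_

module _ {n : ℕ} (H : Graph n) where
  open Graph H

  infixr 5 _∷_

  data Walk : Fin n → Fin n → ℕ → Set where
    []  : ∀ {a} → Walk a a 0
    _∷_ : ∀ {a b c k} → a ~ b → Walk b c k → Walk a c (suc k)

  Connected : Set
  Connected = ∀ a b → ∃ λ k → Walk a b k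

  IsDistance : Fin n → Fin n → ℕ → Set
  IsDistance a b k = Walk a b k × (∀ {j} → Walk a b j → k ≤ j)

  walk? : ∀ a b k → Dec (Walk a b k)
  walk? a b zero    = map′ (λ { refl → [] }) (λ { [] → refl }) (a ≟ᶠ b)
  walk? a b (suc k) =
    map′ (λ { (c , e , w) → e ∷ w }) (λ { (e ∷ w) → _ , e , w })
         (any? (λ c → (a ~? c) ×-dec walk? c b k))

module _ {P : ℕ → Set} (P? : ∀ k → Dec (P k)) where

  least : ∀ k → P k → ∃ λ m → P m × (∀ {j} → P j → m ≤ j)
  least k pk = search k 0 (subst P (sym (+-identityʳ k)) pk) λ ()
    where
    search : ∀ f m → P (f + m) → (∀ {j} → j < m → ¬ P j) →
             ∃ λ m → P m × (∀ {j} → P j → m ≤ j)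
    search f m p below with P? m
    ... | yes pm = m , pm , λ pj → ≮⇒≥ (λ j<m → below j<m pj)
    search zero    m p below | no ¬pm = contradiction p ¬pm
    search (suc f) m p below | no ¬pm =
      search f (suc m) (subst P (sym (+-suc f m)) p) below′
      where
      below′ : ∀ {j} → j < suc m → ¬ P j
      below′ j<1+m pj with m≤n⇒m<n∨m≡n (≤-pred j<1+m)
      ... | inj₁ j<m  = below j<m pj
      ... | inj₂ refl = ¬pm pj

module _ {n : ℕ} (H : Graph n) (conn : Connected H) where
  open Graph H

  private
    shortest : ∀ a b → ∃ (IsDistance H a b)
    shortest a b = least (walk? H a b) (proj₁ (conn a b)) (proj₂ (conn a b))

  distance : Fin n → Fin n → ℕ
  distance a b = proj₁ (shortest a b)

  distance-isDistance : ∀ a b → IsDistance H a b (distance a b)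
  distance-isDistance a b = proj₂ (shortest a b)

  n₁ n₂ : Fin n → Fin n → ℕ
  n₁ a b = count (λ x → distance x a <? distance x b)
  n₂ a b = count (λ x → distance x b <? distance x a)

  -- The condition a < b on vertex labels selects each undirected edge once.
  Sz : ℕ
  Sz = ∑[ a < n ] sumOver (λ b → (a <ᶠ? b) ×-dec (a ~? b)) (λ b → n₁ a b * n₂ a b)

deleteVertex : ∀ {n} → Graph n → Fin n → Graph (pred n)
deleteVertex {suc n} H v = record
  { _~_      = λ a b → punchIn v a ~ punchIn v b
  ; _~?_     = λ a b → punchIn v a ~? punchIn v b
  ; ~-sym    = ~-sym
  ; ~-irrefl = λ a≡b → ~-irrefl (cong (punchIn v) a≡b)
  }
  where open Graph H

record FiniteGroup : Set₁ where
  field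
    group       : Group 0ℓ 0ℓ
    order       : ℕ
    enumeration : Inverse (setoid (Fin order)) (Group.setoid group)

  open Group group public hiding (setoid; refl; sym; trans; reflexive)
  open Inverse enumeration public
    using () renaming (to to element; from to index)

  -- Exponentiation: m ⊗ x is the m-th power of x.
  open RawMonoidDefinitions rawMonoid public
    using () renaming (_×_ to infixr 8 _⊗_)

  IsPowerOf : Rel Carrier 0ℓ
  IsPowerOf u v = ∃ λ m → u ≈ m ⊗ v

module _ (G : FiniteGroup) where
  open FiniteGroup G
  private
    module G = Group group
    module E = Inverse enumeration
    module M = MonoidMult monoid

  element-index : ∀ x → element (index x) ≈ x
  element-index = E.strictlyInverseˡ

  index-injective : ∀ {x y} → index x ≡ index y → x ≈ y
  index-injective {x} {y} eq =
    G.trans (G.sym (element-index x)) (G.trans (E.to-cong eq) (element-index y))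

  _≈?_ : Decidable _≈_
  x ≈? y = map′ index-injective E.from-cong (index x ≟ᶠ index y)

  -- Only the exponents up to the group order matter, so being a power is
  -- decidable.
  power-bounded : ∀ x m → ∃ λ (k : Fin (suc order)) → m ⊗ x ≈ toℕ k ⊗ x
  power-bounded x with pigeonhole (n<1+n order) (λ i → index (toℕ i ⊗ x))
  ... | i , j , i<j , eq = <-rec _ bound
    where
    open SetoidReasoning (Group.setoid group)
    bound : ∀ m → (∀ {l} → l < m → ∃ λ (k : Fin (suc order)) → l ⊗ x ≈ toℕ k ⊗ x) →
            ∃ λ (k : Fin (suc order)) → m ⊗ x ≈ toℕ k ⊗ x
    bound m rec with m <? suc order
    ... | yes m<N = fromℕ< m<N , M.×-congˡ (sym (toℕ-fromℕ< m<N))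
    ... | no  m≮N = proj₁ ih , (begin
      m ⊗ x                            ≡⟨ cong (_⊗ x) (m∸n+n≡m j≤m) ⟨
      (m ∸ toℕ j + toℕ j) ⊗ x          ≈⟨ M.×-homo-+ x (m ∸ toℕ j) (toℕ j) ⟩
      (m ∸ toℕ j) ⊗ x ∙ toℕ j ⊗ x      ≈⟨ ∙-congˡ (index-injective eq) ⟨
      (m ∸ toℕ j) ⊗ x ∙ toℕ i ⊗ x      ≈⟨ M.×-homo-+ x (m ∸ toℕ j) (toℕ i) ⟨
      (m ∸ toℕ j + toℕ i) ⊗ x          ≈⟨ proj₂ ih ⟩
      toℕ (proj₁ ih) ⊗ x               ∎)
      where
      j≤m : toℕ j ≤ m
      j≤m = ≤-trans (<⇒≤ (toℕ<n j)) (≮⇒≥ m≮N)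
      smaller : m ∸ toℕ j + toℕ i < m
      smaller = subst (m ∸ toℕ j + toℕ i <_) (m∸n+n≡m j≤m) (+-monoʳ-< (m ∸ toℕ j) i<j)
      ih = rec smaller

  isPowerOf? : Decidable IsPowerOf
  isPowerOf? u v =
    map′ (λ { (k , eq) → toℕ k , eq })
         (λ { (m , eq) → proj₁ (power-bounded v m) , G.trans eq (proj₂ (power-bounded v m)) })
         (any? (λ k → u ≈? (toℕ k ⊗ v)))

  -- The vertex i stands for the group element  element i.
  𝒫 : Graph order
  𝒫 = record
    { _~_      = λ u v → u ≢ v × (IsPowerOf (element u) (element v) ⊎
                                  IsPowerOf (element v) (element u))
    ; _~?_     = λ u v → ¬? (u ≟ᶠ v) ×-dec (isPowerOf? (element u) (element v) ⊎-dec
                                            isPowerOf? (element v) (element u))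
    ; ~-sym    = λ { (u≢v , p) → (λ v≡u → u≢v (sym v≡u)) , swap p }
    ; ~-irrefl = λ u≡v u~v → proj₁ u~v u≡v
    }

  𝒫* : Graph (pred order)
  𝒫* = deleteVertex 𝒫 (index ε)

module _ {n : ℕ} (H : Graph n) where
  open Graph H

  hub⇒connected : ∀ c → (∀ a → a ≢ c → a ~ c) → Connected H
  hub⇒connected c hub a b with a ≟ᶠ c | b ≟ᶠ c
  ... | yes refl | yes refl = 0 , []
  ... | yes refl | no b≢c   = 1 , ~-sym (hub b b≢c) ∷ []
  ... | no a≢c   | yes refl = 1 , hub a a≢c ∷ []
  ... | no a≢c   | no b≢c   = 2 , hub a a≢c ∷ ~-sym (hub b b≢c) ∷ []

𝒫-connected : (G : FiniteGroup) → Connected (𝒫 G)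
𝒫-connected G = hub⇒connected (𝒫 G) (index ε) λ a a≢c → a≢c , inj₂ (0 , element-index G ε)
  where open FiniteGroup G

module _ (n : ℕ) .{{_ : NonZero n}} where

  infixl 6 _⊕_

  _⊕_ : Fin n → Fin n → Fin n
  a ⊕ b = (toℕ a + toℕ b) mod n

  ⊖_ : Fin n → Fin n
  ⊖ a = (n ∸ toℕ a) mod n

  private
    toℕ-mod : ∀ m → toℕ (m mod n) ≡ m % n
    toℕ-mod m = toℕ-fromℕ< (m%n<n m n)

    mod-cong : ∀ {l m} → l % n ≡ m % n → l mod n ≡ m mod n
    mod-cong eq = toℕ-injective (trans (toℕ-mod _) (trans eq (sym (toℕ-mod _))))

  mod-toℕ : ∀ a → toℕ a mod n ≡ a
  mod-toℕ a = toℕ-injective (trans (toℕ-mod _) (m<n⇒m%n≡m (toℕ<n a)))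

  mod-homo-+ : ∀ l m → (l + m) mod n ≡ l mod n ⊕ m mod n
  mod-homo-+ l m = mod-cong (trans (%-distribˡ-+ l m n)
    (sym (cong₂ (λ x y → (x + y) % n) (toℕ-mod l) (toℕ-mod m))))

  private
    ⊕-comm : ∀ a b → a ⊕ b ≡ b ⊕ a
    ⊕-comm a b = cong (_mod n) (+-comm (toℕ a) (toℕ b))

    ⊕-assoc : ∀ a b c → (a ⊕ b) ⊕ c ≡ a ⊕ (b ⊕ c)
    ⊕-assoc a b c = begin
      (x + y) mod n ⊕ c            ≡⟨ cong ((x + y) mod n ⊕_) (mod-toℕ c) ⟨
      (x + y) mod n ⊕ z mod n      ≡⟨ mod-homo-+ (x + y) z ⟨
      (x + y + z) mod n            ≡⟨ cong (_mod n) (+-assoc x y z) ⟩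
      (x + (y + z)) mod n          ≡⟨ mod-homo-+ x (y + z) ⟩
      x mod n ⊕ (y + z) mod n      ≡⟨ cong (_⊕ (y + z) mod n) (mod-toℕ a) ⟩
      a ⊕ (b ⊕ c)                  ∎
      where
      open ≡-Reasoning
      x = toℕ a
      y = toℕ b
      z = toℕ c

    ⊕-identityˡ : ∀ a → 0 mod n ⊕ a ≡ a
    ⊕-identityˡ a = begin
      0 mod n ⊕ a              ≡⟨ cong (0 mod n ⊕_) (mod-toℕ a) ⟨
      0 mod n ⊕ toℕ a mod n    ≡⟨ mod-homo-+ 0 (toℕ a) ⟨
      toℕ a mod n              ≡⟨ mod-toℕ a ⟩
      a                        ∎
      where open ≡-Reasoning

    n-mod-n : n mod n ≡ 0 mod n
    n-mod-n = mod-cong (trans (n%n≡0 n) (sym (m<n⇒m%n≡m (>-nonZero⁻¹ n))))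

    ⊖-inverseˡ : ∀ a → ⊖ a ⊕ a ≡ 0 mod n
    ⊖-inverseˡ a = begin
      ⊖ a ⊕ a                       ≡⟨ cong (⊖ a ⊕_) (mod-toℕ a) ⟨
      ⊖ a ⊕ toℕ a mod n             ≡⟨ mod-homo-+ (n ∸ toℕ a) (toℕ a) ⟨
      (n ∸ toℕ a + toℕ a) mod n     ≡⟨ cong (_mod n) (m∸n+n≡m (<⇒≤ (toℕ<n a))) ⟩
      n mod n                       ≡⟨ n-mod-n ⟩
      0 mod n                       ∎
      where open ≡-Reasoning

  ℤ/-abelianGroup : AbelianGroup 0ℓ 0ℓ
  ℤ/-abelianGroup = record
    { Carrier = Fin n
    ; _≈_     = _≡_
    ; _∙_     = _⊕_
    ; ε       = 0 mod n
    ; _⁻¹     = ⊖_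
    ; isAbelianGroup = record
      { isGroup = record
        { isMonoid = record
          { isSemigroup = record
            { isMagma = record { isEquivalence = isEquivalence ; ∙-cong = cong₂ _⊕_ }
            ; assoc   = ⊕-assoc
            }
          ; identity = ⊕-identityˡ , λ a → trans (⊕-comm a _) (⊕-identityˡ a)
          }
        ; inverse = ⊖-inverseˡ , λ a → trans (⊕-comm a _) (⊖-inverseˡ a)
        ; ⁻¹-cong = cong ⊖_
        }
      ; comm = ⊕-comm
      }
    }

  ℤ/_ : FiniteGroup
  ℤ/_ = record
    { group       = AbelianGroup.group ℤ/-abelianGroup
    ; order       = n
    ; enumeration = Identity.inverse (setoid (Fin n))
    }

  multiple-of-one : ∀ m → FiniteGroup._⊗_ ℤ/_ m (1 mod n) ≡ m mod n
  multiple-of-one zero    = refl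
  multiple-of-one (suc m) =
    trans (cong (1 mod n ⊕_) (multiple-of-one m)) (sym (mod-homo-+ 1 m))

𝒫*-ℤ/-connected : ∀ n .{{_ : NonZero n}} → Connected (𝒫* (ℤ/ n))
𝒫*-ℤ/-connected (suc zero)      ()
𝒫*-ℤ/-connected n@(suc (suc _)) = hub⇒connected (𝒫* (ℤ/ n)) zero
  λ a a≢0 → (λ eq → a≢0 (punchIn-injective zero a zero eq))
          , inj₁ (toℕ (suc a) , sym (trans (multiple-of-one n (toℕ (suc a))) (mod-toℕ n (suc a))))

-- The dihedral group of order 2n, through the normal forms rⁱ and srⁱ of its
-- elements, with exponents i taken modulo n.

pattern r^_ i  = inj₁ i
pattern sr^_ i = inj₂ i

module _ (n : ℕ) .{{_ : NonZero n}} where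

  private
    module A = AbelianGroup (ℤ/-abelianGroup n)
    open A using (_∙_; _⁻¹; ε)

  Dihedral : Set
  Dihedral = Fin n ⊎ Fin n

  infixl 7 _·_

  -- rⁱs = sr⁻ⁱ
  _·_ : Dihedral → Dihedral → Dihedral
  (r^ i)  · (r^ j)  = r^ (i ∙ j)
  (r^ i)  · (sr^ j) = sr^ (i ⁻¹ ∙ j)
  (sr^ i) · (r^ j)  = sr^ (i ∙ j)
  (sr^ i) · (sr^ j) = r^ (i ⁻¹ ∙ j)

  inv : Dihedral → Dihedral
  inv (r^ i)  = r^ (i ⁻¹)
  inv (sr^ i) = sr^ i

  private
    open GroupProperties A.group using (⁻¹-involutive)
    open AbelianGroupProperties (ℤ/-abelianGroup n) using (⁻¹-∙-comm)

    lem₁ : ∀ i j k → (i ∙ j) ⁻¹ ∙ k ≡ i ⁻¹ ∙ (j ⁻¹ ∙ k)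
    lem₁ i j k = trans (cong (_∙ k) (sym (⁻¹-∙-comm i j))) (A.assoc (i ⁻¹) (j ⁻¹) k)

    lem₂ : ∀ i j k → (i ⁻¹ ∙ j) ⁻¹ ∙ k ≡ i ∙ (j ⁻¹ ∙ k)
    lem₂ i j k = trans (lem₁ (i ⁻¹) j k) (cong (_∙ (j ⁻¹ ∙ k)) (⁻¹-involutive i))

    ·-assoc : ∀ x y z → (x · y) · z ≡ x · (y · z)
    ·-assoc (r^ i)  (r^ j)  (r^ k)  = cong r^_ (A.assoc i j k)
    ·-assoc (r^ i)  (r^ j)  (sr^ k) = cong sr^_ (lem₁ i j k)
    ·-assoc (r^ i)  (sr^ j) (r^ k)  = cong sr^_ (A.assoc (i ⁻¹) j k)
    ·-assoc (r^ i)  (sr^ j) (sr^ k) = cong r^_ (lem₂ i j k)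
    ·-assoc (sr^ i) (r^ j)  (r^ k)  = cong sr^_ (A.assoc i j k)
    ·-assoc (sr^ i) (r^ j)  (sr^ k) = cong r^_ (lem₁ i j k)
    ·-assoc (sr^ i) (sr^ j) (r^ k)  = cong r^_ (A.assoc (i ⁻¹) j k)
    ·-assoc (sr^ i) (sr^ j) (sr^ k) = cong sr^_ (lem₂ i j k)

    ·-identityˡ : ∀ x → (r^ ε) · x ≡ x
    ·-identityˡ (r^ i)  = cong r^_ (A.identityˡ i)
    ·-identityˡ (sr^ i) = cong sr^_ (trans (cong (_∙ i) (GroupProperties.ε⁻¹≈ε A.group)) (A.identityˡ i))

    ·-identityʳ : ∀ x → x · (r^ ε) ≡ x
    ·-identityʳ (r^ i)  = cong r^_ (A.identityʳ i)
    ·-identityʳ (sr^ i) = cong sr^_ (A.identityʳ i)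

    inv-inverseˡ : ∀ x → inv x · x ≡ (r^ ε)
    inv-inverseˡ (r^ i)  = cong r^_ (A.inverseˡ i)
    inv-inverseˡ (sr^ i) = cong r^_ (A.inverseˡ i)

    inv-inverseʳ : ∀ x → x · inv x ≡ (r^ ε)
    inv-inverseʳ (r^ i)  = cong r^_ (A.inverseʳ i)
    inv-inverseʳ (sr^ i) = cong r^_ (A.inverseˡ i)

  𝔻-group : Group 0ℓ 0ℓ
  𝔻-group = record
    { Carrier = Dihedral
    ; _≈_     = _≡_
    ; _∙_     = _·_
    ; ε       = r^ ε
    ; _⁻¹     = inv
    ; isGroup = record
      { isMonoid = record
        { isSemigroup = record
          { isMagma = record { isEquivalence = isEquivalence ; ∙-cong = cong₂ _·_ }
          ; assoc   = ·-assoc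
          }
        ; identity = ·-identityˡ , ·-identityʳ
        }
      ; inverse = inv-inverseˡ , inv-inverseʳ
      ; ⁻¹-cong = cong inv
      }
    }

  𝔻_ : FiniteGroup
  𝔻_ = record
    { group       = 𝔻-group
    ; order       = n + n
    ; enumeration = +↔⊎
    }

-- The generators r, s satisfy rⁿ = s² = 1 and rs = sr⁻¹ and generate the whole
-- group.  The group presented by these relations has at most 2n elements, so,
-- having exactly 2n elements, 𝔻 n is that group.
module _ (n : ℕ) .{{_ : NonZero n}} where

  open FiniteGroup (𝔻 n) using (_⊗_; _∙_; _⁻¹; ε)

  r s : Dihedral n
  r = r^ (1 mod n)
  s = sr^ (0 mod n)

  private
    module A = AbelianGroup (ℤ/-abelianGroup n)

    powers-of-r : ∀ m → m ⊗ r ≡ r^ (m mod n)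
    powers-of-r m = trans (lift m) (cong inj₁ (multiple-of-one n m))
      where
      lift : ∀ m → m ⊗ r ≡ r^ (FiniteGroup._⊗_ (ℤ/ n) m (1 mod n))
      lift zero    = refl
      lift (suc m) = cong (r ∙_) (lift m)

  rⁿ≡1 : n ⊗ r ≡ ε
  rⁿ≡1 = trans (powers-of-r n) (cong inj₁ n-mod-n)
    where
    n-mod-n : n mod n ≡ 0 mod n
    n-mod-n = toℕ-injective (trans (toℕ-fromℕ< _) (trans (n%n≡0 n)
      (sym (trans (toℕ-fromℕ< _) (m<n⇒m%n≡m (>-nonZero⁻¹ n))))))

  s²≡1 : 2 ⊗ s ≡ ε
  s²≡1 = trans (cong (s ∙_) (FiniteGroup.identityʳ (𝔻 n) s)) (cong inj₁ (A.inverseˡ (0 mod n)))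

  rs≡sr⁻¹ : r ∙ s ≡ s ∙ r ⁻¹
  rs≡sr⁻¹ = cong inj₂ (A.comm (A._⁻¹ (1 mod n)) (0 mod n))

  r,s-generate : ∀ x → ∃ λ e → ∃ λ m → x ≡ e ⊗ s ∙ m ⊗ r
  r,s-generate (r^ i)  = 0 , toℕ i ,
    sym (trans (FiniteGroup.identityˡ (𝔻 n) _) (trans (powers-of-r (toℕ i)) (cong inj₁ (mod-toℕ n i))))
  r,s-generate (sr^ i) = 1 , toℕ i , sym (begin
    1 ⊗ s ∙ toℕ i ⊗ r     ≡⟨ cong₂ _∙_ (FiniteGroup.identityʳ (𝔻 n) s)
                              (trans (powers-of-r (toℕ i)) (cong inj₁ (mod-toℕ n i))) ⟩
    s ∙ (r^ i)            ≡⟨ cong inj₂ (A.identityˡ i) ⟩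
    sr^ i                 ∎)
    where open ≡-Reasoning

module Submission where

-- In the power graph of 𝔻 n the rotations induce the power graph of ℤ/n, the
-- identity is adjacent to everything, and each reflection is a pendant vertex
-- attached to the identity.  The graph 𝒫* (ℤ/ n) is dominated by the generator 1,
-- so its distances agree with those in 𝒫 (𝔻 n), and the identity and the
-- reflections are equidistant from the ends of each of its edges: these edges
-- contribute Sz (𝒫* (ℤ/ n)).  For an edge from the identity to b, only b itself
-- is closer to b, while the identity is closer to itself and to every vertex not
-- adjacent to b.  Two elements of ℤ/n are adjacent exactly when one of their
-- orders divides the other, so counting the elements of each order turns these
-- contributions into totients.

open import Defs
open import Data.Bool.Base using (true; false; if_then_else_)
open import Data.Fin.Base using (Fin; zero; suc; toℕ; fromℕ<; splitAt; _↑ˡ_; _↑ʳ_) renaming (_<_ to _<ᶠ_)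
open import Data.Fin.Properties
  using (suc-injective; toℕ-injective; toℕ-fromℕ<; toℕ<n; toℕ-↑ˡ; ↑ˡ-injective; splitAt-↑ˡ; splitAt-↑ʳ)
  renaming (_≟_ to _≟ᶠ_; _<?_ to _<ᶠ?_; <-cmp to <ᶠ-cmp)
open import Data.Nat.Base
open import Data.Nat.Coprimality using (Coprime; coprime?; coprime⇒gcd≡1; gcd≡1⇒coprime)
open import Data.Nat.Divisibility
open import Data.Nat.DivMod using (_%_; _mod_; m%n<n; m<n⇒m%n≡m; [m+kn]%n≡m%n)
open import Data.Nat.GCD
  using (gcd; gcd[m,n]∣m; gcd[m,n]∣n; gcd[m,n]≢0; gcd-greatest; gcd-GCD; c*gcd[m,n]≡gcd[cm,cn]; module Bézout)
open import Data.Nat.Properties hiding (suc-injective)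
import Data.Nat.Properties as ℕ
open import Algebra.Properties.CommutativeMonoid.Sum +-0-commutativeMonoid
  using (∑-comm; sum-cong-≗; sum-replicate-zero)
open import Algebra.Properties.Semiring.Sum +-*-semiring using (*-distribˡ-sum)
open import Data.Nat.Tactic.RingSolver using (solve-∀)
open import Data.Product.Base using (∃; _×_; _,_; proj₁; proj₂)
open import Data.Sum.Base as Sum using (_⊎_; inj₁; inj₂)
open import Data.Sum.Properties using (inj₁-injective)
open import Function.Base using (_∘_; case_of_)
open import Function.Bundles using (_⇔_; mk⇔; Equivalence; Inverse)
open import Relation.Binary.Definitions using (tri<; tri≈; tri>)
open import Relation.Binary.PropositionalEquality
open import Relation.Nullary.Decidable using (Dec; yes; no; does; ¬?; dec-true; dec-false; _×-dec_; _⊎-dec_)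
open import Relation.Nullary.Negation using (¬_; contradiction)
open import Relation.Unary using () renaming (Decidable to Decidable₁)

open Equivalence using (to; from)

-- Finite sums and counting.

private
  variable
    m p : ℕ
    A B : Set
    P Q : Fin p → Set

if-yes : (a? : Dec A) {x y : ℕ} → A → (if does a? then x else y) ≡ x
if-yes a? a = cong (if_then _ else _) (dec-true a? a)

if-no : (a? : Dec A) {x y : ℕ} → ¬ A → (if does a? then x else y) ≡ y
if-no a? ¬a = cong (if_then _ else _) (dec-false a? ¬a)

if-cong : (a? : Dec A) (b? : Dec B) {x y : ℕ} → A ⇔ B → (A → x ≡ y) →
          (if does a? then x else 0) ≡ (if does b? then y else 0)
if-cong (yes a) b? A⇔B x≡y = trans (x≡y a) (sym (if-yes b? (to A⇔B a)))
if-cong (no ¬a) b? A⇔B x≡y = sym (if-no b? (¬a ∘ from A⇔B))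

sumOver-cong : (P? : Decidable₁ P) (Q? : Decidable₁ Q) (f g : Fin p → ℕ) → (∀ i → P i ⇔ Q i) →
               (∀ i → P i → f i ≡ g i) → sumOver P? f ≡ sumOver Q? g
sumOver-cong P? Q? f g P⇔Q f≡g = sum-cong-≗ λ i → if-cong (P? i) (Q? i) (P⇔Q i) (f≡g i)

count-cong : (P? : Decidable₁ P) (Q? : Decidable₁ Q) → (∀ i → P i ⇔ Q i) → count P? ≡ count Q?
count-cong P? Q? P⇔Q = sumOver-cong P? Q? (λ _ → 1) (λ _ → 1) P⇔Q λ _ _ → refl

sumOver-none : (P? : Decidable₁ P) (f : Fin p → ℕ) → (∀ i → ¬ P i) → sumOver P? f ≡ 0
sumOver-none {p} P? f ¬P = trans
  (sum-cong-≗ λ i → if-no (P? i) (¬P i))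
  (sum-replicate-zero p)

sumOver-all : (P? : Decidable₁ P) (f : Fin p → ℕ) → (∀ i → P i) → sumOver P? f ≡ ∑[ i < p ] f i
sumOver-all P? f allP = sum-cong-≗ λ i → if-yes (P? i) (allP i)

sumOver-unique : (P? : Decidable₁ P) (f : Fin p → ℕ) (c : Fin p) →
                 P c → (∀ i → P i → i ≡ c) → sumOver P? f ≡ f c
sumOver-unique P? f zero    Pc unique = trans
  (cong₂ _+_ (if-yes (P? zero) Pc)
             (sumOver-none (P? ∘ suc) (f ∘ suc) λ i Pi → case unique (suc i) Pi of λ ()))
  (+-identityʳ (f zero))
sumOver-unique P? f (suc c) Pc unique =
  cong₂ _+_ (if-no (P? zero) λ P0 → case unique zero P0 of λ ())
            (sumOver-unique (P? ∘ suc) (f ∘ suc) c Pc λ i Pi → suc-injective (unique (suc i) Pi))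

∑-const : ∀ p x → ∑[ _ < p ] x ≡ p * x
∑-const zero    x = refl
∑-const (suc p) x = cong (x +_) (∑-const p x)

count-all : (P? : Decidable₁ {A = Fin p} P) → (∀ i → P i) → count P? ≡ p
count-all {p = p} P? allP = trans (sumOver-all P? (λ _ → 1) allP) (trans (∑-const p 1) (*-identityʳ p))

count-¬ : (P? : Decidable₁ {A = Fin p} P) → count P? + count (¬? ∘ P?) ≡ p
count-¬ {zero}  P? = refl
count-¬ {suc p} P? with P? zero
... | yes _ = cong suc (count-¬ (P? ∘ suc))
... | no  _ = trans (+-suc _ _) (cong suc (count-¬ (P? ∘ suc)))

count-≢ : (c : Fin (suc p)) → count (λ i → ¬? (i ≟ᶠ c)) ≡ p
count-≢ {p} c = +-cancelˡ-≡ 1 (count (λ i → ¬? (i ≟ᶠ c))) p (trans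
  (cong (_+ count (λ i → ¬? (i ≟ᶠ c))) (sym (sumOver-unique (_≟ᶠ c) (λ _ → 1) c refl λ _ i≡c → i≡c)))
  (count-¬ (_≟ᶠ c)))

∑-↑ : ∀ m {p} (f : Fin (m + p) → ℕ) →
      ∑[ i < m + p ] f i ≡ ∑[ i < m ] f (i ↑ˡ p) + ∑[ j < p ] f (m ↑ʳ j)
∑-↑ zero    f = refl
∑-↑ (suc m) f = trans (cong (f zero +_) (∑-↑ m (f ∘ suc))) (sym (+-assoc (f zero) _ _))

sumOver-const : (P? : Decidable₁ {A = Fin p} P) (x : ℕ) → sumOver P? (λ _ → x) ≡ x * count P?
sumOver-const P? x = sym (trans
  (*-distribˡ-sum x (λ i → if does (P? i) then 1 else 0))
  (sum-cong-≗ λ i → times (does (P? i))))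
  where
  times : ∀ b → x * (if b then 1 else 0) ≡ (if b then x else 0)
  times true  = *-identityʳ x
  times false = *-zeroʳ x

-- Double counting of the pairs (i , j) with R i j.
count-bijection : {R : Fin m → Fin p → Set} (R? : ∀ i j → Dec (R i j))
  (P? : Decidable₁ {A = Fin m} P) (Q? : Decidable₁ {A = Fin p} Q) →
  (∀ {i j} → R i j → P i × Q j) →
  (∀ {i} → P i → ∃ (R i)) → (∀ {i j k} → R i j → R i k → j ≡ k) →
  (∀ {j} → Q j → ∃ λ i → R i j) → (∀ {i k j} → R i j → R k j → i ≡ k) →
  count P? ≡ count Q?
count-bijection {m} {p} R? P? Q? R⇒ total functional surjective injective = begin
  count P?
    ≡⟨ sum-cong-≗ row ⟩
  (∑[ i < m ] ∑[ j < p ] (if does (R? i j) then 1 else 0))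
    ≡⟨ ∑-comm (λ i j → if does (R? i j) then 1 else 0) ⟩
  (∑[ j < p ] ∑[ i < m ] (if does (R? i j) then 1 else 0))
    ≡⟨ sum-cong-≗ column ⟨
  count Q? ∎
  where
  open ≡-Reasoning
  row : ∀ i → (if does (P? i) then 1 else 0) ≡ count (R? i)
  row i with P? i
  ... | yes Pi = let (j , Rij) = total Pi in
    sym (sumOver-unique (R? i) (λ _ → 1) j Rij λ k Rik → functional Rik Rij)
  ... | no ¬Pi = sym (sumOver-none (R? i) (λ _ → 1) λ j Rij → ¬Pi (proj₁ (R⇒ Rij)))
  column : ∀ j → (if does (Q? j) then 1 else 0) ≡ count (λ i → R? i j)
  column j with Q? j
  ... | yes Qj = let (i , Rij) = surjective Qj in
    sym (sumOver-unique (λ i → R? i j) (λ _ → 1) i Rij λ k Rkj → injective Rkj Rij)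
  ... | no ¬Qj = sym (sumOver-none (λ i → R? i j) (λ _ → 1) λ i Rij → ¬Qj (proj₂ (R⇒ Rij)))

-- Each `h (key x)` is a sum over `i` whose only nonzero term is the one with `key x ≡ d i`;
-- exchanging the two sums collects the fibres of `key`.
∑-fibres : (key : Fin m → ℕ) (d : Fin p → ℕ) → (∀ {i j} → d i ≡ d j → i ≡ j) →
           (∀ x → ∃ λ i → key x ≡ d i) → (h : ℕ → ℕ) →
           ∑[ x < m ] h (key x) ≡ ∑[ i < p ] (h (d i) * count (λ x → key x ≟ d i))
∑-fibres {m} {p} key d d-injective covers h = begin
  (∑[ x < m ] h (key x))
    ≡⟨ sum-cong-≗ fibre ⟩
  (∑[ x < m ] ∑[ i < p ] (if does (key x ≟ d i) then h (d i) else 0))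
    ≡⟨ ∑-comm (λ x i → if does (key x ≟ d i) then h (d i) else 0) ⟩
  (∑[ i < p ] ∑[ x < m ] (if does (key x ≟ d i) then h (d i) else 0))
    ≡⟨ sum-cong-≗ (λ i → sumOver-const (λ x → key x ≟ d i) (h (d i))) ⟩
  (∑[ i < p ] (h (d i) * count (λ x → key x ≟ d i))) ∎
  where
  open ≡-Reasoning
  fibre : ∀ x → h (key x) ≡ sumOver (λ i → key x ≟ d i) (h ∘ d)
  fibre x = let (i , eq) = covers x in sym (trans
    (sumOver-unique (λ i → key x ≟ d i) (h ∘ d) i eq λ j eq′ → d-injective (trans (sym eq′) eq))
    (cong h (sym eq)))

-- Distances in graphs with a dominating vertex

Dominating : Graph p → Fin p → Set
Dominating H c = ∀ a → a ≢ c → Graph._~_ H a c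

module _ (H : Graph p) (conn : Connected H) where
  open Graph H

  private
    dist = distance H conn

  distance-unique : ∀ {a b k} → IsDistance H a b k → dist a b ≡ k
  distance-unique {a} {b} (w , minimal) with distance-isDistance H conn a b
  ... | w′ , minimal′ = ≤-antisym (minimal′ w) (minimal w′)

  distance-refl : ∀ a → dist a a ≡ 0
  distance-refl a = distance-unique {a} {a} ([] , λ _ → z≤n)

  distance≡0⇒≡ : ∀ {a b} → dist a b ≡ 0 → a ≡ b
  distance≡0⇒≡ {a} {b} eq = endpoints (subst (Walk H a b) eq (proj₁ (distance-isDistance H conn a b)))
    where
    endpoints : ∀ {a b} → Walk H a b 0 → a ≡ b
    endpoints [] = refl

  distance-adjacent : ∀ {a b} → a ~ b → dist a b ≡ 1
  distance-adjacent {a} {b} a~b = distance-unique (a~b ∷ [] , minimal)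
    where
    minimal : ∀ {j} → Walk H a b j → 1 ≤ j
    minimal []      = contradiction a~b (~-irrefl refl)
    minimal (_ ∷ _) = s≤s z≤n

  distance-two : ∀ {a b c} → a ≢ b → ¬ a ~ b → a ~ c → c ~ b → dist a b ≡ 2
  distance-two {a} {b} a≢b a≁b a~c c~b = distance-unique (a~c ∷ c~b ∷ [] , minimal)
    where
    minimal : ∀ {j} → Walk H a b j → 2 ≤ j
    minimal []          = contradiction refl a≢b
    minimal (a~b ∷ [])  = contradiction a~b a≁b
    minimal (_ ∷ _ ∷ _) = s≤s (s≤s z≤n)

  module _ {c : Fin p} (dom : Dominating H c) where

    -- The path through `c` has length 2: neither end is `c`, since `c` is adjacent to every other
    -- vertex. Distances are thus 0, 1 or 2, decided by equality and adjacency.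
    distance-nonadjacent : ∀ {a b} → a ≢ b → ¬ a ~ b → dist a b ≡ 2
    distance-nonadjacent {a} {b} a≢b a≁b = distance-two a≢b a≁b
      (dom a λ { refl → a≁b (~-sym (dom b (a≢b ∘ sym))) })
      (~-sym (dom b λ { refl → a≁b (dom a a≢b) }))

    distance-dominating : ∀ x → x ≢ c → dist x c ≡ 1
    distance-dominating x x≢c = distance-adjacent (dom x x≢c)

    -- A vertex other than `c` is at distance 1 from `c`, so it is closer to `c` exactly when it is
    -- at distance 2 from `b`.
    closer-to-dominating : ∀ b → b ≢ c → ∀ x →
      dist x c < dist x b ⇔ (x ≡ c ⊎ (x ≢ b × ¬ x ~ b))
    closer-to-dominating b b≢c x = mk⇔ ⇒ ⇐
      where
      ⇒ : dist x c < dist x b → x ≡ c ⊎ (x ≢ b × ¬ x ~ b)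
      ⇒ lt = case x ≟ᶠ c of λ
        { (yes x≡c) → inj₁ x≡c
        ; (no x≢c)  → inj₂ ( (λ x≡b → bound x≢c z≤n (trans (cong (dist x) (sym x≡b)) (distance-refl x)))
                           , (λ x~b → bound x≢c ≤-refl (distance-adjacent x~b)))
        }
        where
        bound : x ≢ c → ∀ {k} → k ≤ 1 → dist x b ≢ k
        bound x≢c k≤1 eq = <⇒≱ (subst₂ _<_ (distance-dominating x x≢c) eq lt) k≤1
      ⇐ : x ≡ c ⊎ (x ≢ b × ¬ x ~ b) → dist x c < dist x b
      ⇐ (inj₁ refl) =
        subst₂ _<_ (sym (distance-refl x)) (sym (distance-adjacent (~-sym (dom b b≢c)))) (s≤s z≤n)
      ⇐ (inj₂ (x≢b , x≁b)) = subst₂ _<_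
        (sym (distance-dominating x λ { refl → x≁b (~-sym (dom b b≢c)) }))
        (sym (distance-nonadjacent x≢b x≁b)) ≤-refl

    -- No vertex is farther than 1 from `c`, so being closer to `b` means being at distance 0 from
    -- `b`.
    n₂-dominating : ∀ b → b ≢ c → n₂ H conn c b ≡ 1
    n₂-dominating b b≢c = sumOver-unique (λ x → dist x b <? dist x c) (λ _ → 1) b
      (subst₂ _<_ (sym (distance-refl b)) (sym (distance-dominating b b≢c)) (s≤s z≤n)) only
      where
      only : ∀ x → dist x b < dist x c → x ≡ b
      only x lt = case x ≟ᶠ c of λ
        { (yes x≡c) → contradiction
            (subst (dist x b <_) (trans (cong (dist x) (sym x≡c)) (distance-refl x)) lt) λ ()
        ; (no x≢c)  → distance≡0⇒≡ (n<1⇒n≡0 (subst (dist x b <_) (distance-dominating x x≢c) lt))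
        }

-- In both graphs distances are decided by equality and adjacency, which `ι` preserves and reflects.
-- Nonadjacent images are joined through `e`, wherever `ι` sends `c`.
distance-embedding :
  (G : Graph m) (connG : Connected G) {c : Fin m} → Dominating G c →
  (H : Graph p) (connH : Connected H) {e : Fin p} → Dominating H e →
  (ι : Fin m → Fin p) → (∀ {a b} → ι a ≡ ι b → a ≡ b) →
  (∀ a b → Graph._~_ H (ι a) (ι b) ⇔ Graph._~_ G a b) →
  ∀ a b → distance H connH (ι a) (ι b) ≡ distance G connG a b
distance-embedding G connG domG H connH domH ι ι-injective ι-~ a b = case a ≟ᶠ b of λ
  { (yes a≡b) → trans
      (trans (cong (λ x → distance H connH (ι a) (ι x)) (sym a≡b)) (distance-refl H connH (ι a)))
      (trans (sym (distance-refl G connG a)) (cong (distance G connG a) a≡b))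
  ; (no a≢b) → case Graph._~?_ G a b of λ
    { (yes a~b) → trans (distance-adjacent H connH (from (ι-~ a b) a~b))
                        (sym (distance-adjacent G connG a~b))
    ; (no a≁b)  → trans
        (distance-nonadjacent H connH domH (a≢b ∘ ι-injective) (a≁b ∘ to (ι-~ a b)))
        (sym (distance-nonadjacent G connG domG a≢b a≁b))
    }
  }

-- H is the cone over G with apex zero and p further pendant vertices at the apex.
module _ {N p : ℕ}
  (G : Graph N) (connG : Connected G) {c : Fin N} (domG : Dominating G c)
  (H : Graph (suc N + p)) (connH : Connected H) (domH : Dominating H zero)
  (base-~ : ∀ i j → Graph._~_ H (suc i ↑ˡ p) (suc j ↑ˡ p) ⇔ Graph._~_ G i j)
  (pendant-~ : ∀ l x → Graph._~_ H x (suc N ↑ʳ l) → x ≡ zero)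
  where
  private
    open module H = Graph H using (_~_; _~?_)
    module G = Graph G

    apex : Fin (suc N + p)
    apex = zero

    base : Fin N → Fin (suc N + p)
    base i = suc i ↑ˡ p

    pendant : Fin p → Fin (suc N + p)
    pendant l = suc N ↑ʳ l

    base-injective : ∀ {i j} → base i ≡ base j → i ≡ j
    base-injective eq = suc-injective (↑ˡ-injective p _ _ eq)

    base≢pendant : ∀ {i l} → base i ≢ pendant l
    base≢pendant {i} {l} eq
      with trans (sym (splitAt-↑ˡ (suc N) (suc i) p))
                 (trans (cong (splitAt (suc N)) eq) (splitAt-↑ʳ (suc N) p l))
    ... | ()

    base≁pendant : ∀ {i l} → ¬ base i ~ pendant l
    base≁pendant {i} {l} adj with pendant-~ l (base i) adj
    ... | ()

    ∑-vertices : ∀ f → ∑[ x < suc N + p ] f x ≡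
                 f apex + (∑[ i < N ] f (base i) + ∑[ l < p ] f (pendant l))
    ∑-vertices f = trans (∑-↑ (suc N) f) (+-assoc (f apex) _ _)

    dist = distance H connH

    closer? : ∀ a b x → Dec (dist x a < dist x b)
    closer? a b x = dist x a <? dist x b

    nonadjacent? : ∀ j k → Dec (k ≢ j × ¬ k G.~ j)
    nonadjacent? j k = ¬? (k ≟ᶠ j) ×-dec ¬? (k G.~? j)

    apex~base : ∀ i → apex ~ base i
    apex~base i = H.~-sym (domH (base i) λ ())

    apex~pendant : ∀ l → apex ~ pendant l
    apex~pendant l = H.~-sym (domH (pendant l) λ ())

    sumOver-vertices : {P : Fin (suc N + p) → Set} (P? : Decidable₁ P) (f : Fin (suc N + p) → ℕ) {a b c : ℕ} →
      (if does (P? apex) then f apex else 0) ≡ a →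
      sumOver (P? ∘ base) (f ∘ base) ≡ b →
      sumOver (P? ∘ pendant) (f ∘ pendant) ≡ c →
      sumOver P? f ≡ a + (b + c)
    sumOver-vertices P? f eq₁ eq₂ eq₃ =
      trans (∑-vertices λ x → if does (P? x) then f x else 0) (cong₂ _+_ eq₁ (cong₂ _+_ eq₂ eq₃))

    -- The apex is at distance 1 from both ends and each pendant vertex at distance 2 from both, so
    -- only base vertices count.
    n₁-base : ∀ i j → n₁ H connH (base i) (base j) ≡ n₁ G connG i j
    n₁-base i j = begin
      n₁ H connH (base i) (base j)
        ≡⟨ sumOver-vertices (closer? (base i) (base j)) (λ _ → 1) atApex atBase atPendant ⟩
      n₁ G connG i j + 0
        ≡⟨ +-identityʳ _ ⟩
      n₁ G connG i j ∎
      where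
      open ≡-Reasoning
      atApex : (if does (closer? (base i) (base j) apex) then 1 else 0) ≡ 0
      atApex = if-no (closer? (base i) (base j) apex) λ lt →
        <-irrefl (trans (distance-adjacent H connH (apex~base i))
                        (sym (distance-adjacent H connH (apex~base j)))) lt
      dist-base : ∀ k l → dist (base k) (base l) ≡ distance G connG k l
      dist-base = distance-embedding G connG domG H connH domH base base-injective base-~
      atBase : count (closer? (base i) (base j) ∘ base) ≡ n₁ G connG i j
      atBase = sum-cong-≗ λ k →
        cong₂ (λ u v → if does (u <? v) then 1 else 0) (dist-base k i) (dist-base k j)
      to-base : ∀ l k → dist (pendant l) (base k) ≡ 2
      to-base l k = distance-nonadjacent H connH domH {pendant l} {base k}
        (base≢pendant ∘ sym) (base≁pendant ∘ H.~-sym)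
      atPendant : count (closer? (base i) (base j) ∘ pendant) ≡ 0
      atPendant = sumOver-none (closer? (base i) (base j) ∘ pendant) (λ _ → 1) λ l lt →
        <-irrefl (trans (to-base l i) (sym (to-base l j))) lt

    -- The summand 1 is the apex itself; the `p` pendant vertices all count because none is adjacent
    -- to a base vertex.
    n₁-apex-base : ∀ j → n₁ H connH apex (base j) ≡ p + 1 + count (nonadjacent? j)
    n₁-apex-base j = begin
      n₁ H connH apex (base j)
        ≡⟨ count-cong (closer? apex (base j)) far? (closer-to-dominating H connH domH (base j) λ ()) ⟩
      count far?
        ≡⟨ sumOver-vertices far? (λ _ → 1) refl atBase atPendant ⟩
      1 + (count (nonadjacent? j) + p)
        ≡⟨ rearrange (count (nonadjacent? j)) p ⟩
      p + 1 + count (nonadjacent? j) ∎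
      where
      open ≡-Reasoning
      far? : Decidable₁ (λ x → x ≡ apex ⊎ (x ≢ base j × ¬ x ~ base j))
      far? x = (x ≟ᶠ apex) ⊎-dec (¬? (x ≟ᶠ base j) ×-dec ¬? (x ~? base j))
      atBase : count (far? ∘ base) ≡ count (nonadjacent? j)
      atBase = count-cong (far? ∘ base) (nonadjacent? j) λ k → mk⇔
        (λ { (inj₂ (k≢j , k≁j)) → (k≢j ∘ cong base) , (k≁j ∘ from (base-~ k j)) })
        (λ { (k≢j , k≁j) → inj₂ ((k≢j ∘ base-injective) , (k≁j ∘ to (base-~ k j))) })
      atPendant : count (far? ∘ pendant) ≡ p
      atPendant = count-all (far? ∘ pendant) λ l → inj₂ ((base≢pendant ∘ sym) , (base≁pendant ∘ H.~-sym))
      rearrange : ∀ a b → 1 + (a + b) ≡ b + 1 + a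
      rearrange = solve-∀

    -- The only neighbour of the pendant vertex is the apex, so every vertex except the pendant
    -- vertex itself is closer to the apex.
    n₁-apex-pendant : ∀ l → n₁ H connH apex (pendant l) ≡ N + p
    n₁-apex-pendant l = trans
      (count-cong (closer? apex (pendant l)) (λ x → ¬? (x ≟ᶠ pendant l)) λ x → mk⇔
        (λ lt → other x (to (closer x) lt))
        (λ x≢l → from (closer x) (far x x≢l)))
      (count-≢ (pendant l))
      where
      closer : ∀ x → dist x apex < dist x (pendant l) ⇔ (x ≡ apex ⊎ (x ≢ pendant l × ¬ x ~ pendant l))
      closer = closer-to-dominating H connH domH (pendant l) λ ()
      other : ∀ x → x ≡ apex ⊎ (x ≢ pendant l × ¬ x ~ pendant l) → x ≢ pendant l
      other x (inj₁ refl)      = λ ()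
      other x (inj₂ (x≢l , _)) = x≢l
      far : ∀ x → x ≢ pendant l → x ≡ apex ⊎ (x ≢ pendant l × ¬ x ~ pendant l)
      far x x≢l with x ~? pendant l
      ... | yes x~l = inj₁ (pendant-~ l x x~l)
      ... | no  x≁l = inj₂ (x≢l , x≁l)

    edge? : ∀ a b → Dec (a <ᶠ b × a ~ b)
    edge? a b = (a <ᶠ? b) ×-dec (a ~? b)

    weight : Fin (suc N + p) → Fin (suc N + p) → ℕ
    weight a b = n₁ H connH a b * n₂ H connH a b

    weight-apex : ∀ b → b ≢ apex → weight apex b ≡ n₁ H connH apex b
    weight-apex b b≢apex = trans
      (cong (n₁ H connH apex b *_) (n₂-dominating H connH domH b b≢apex)) (*-identityʳ _)

    -- With the order of labels kept, an edge of `G` is counted from the same end in both Szeged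
    -- sums.
    base-monotone : ∀ i j → base i <ᶠ base j ⇔ i <ᶠ j
    base-monotone i j = mk⇔
      (λ lt → ≤-pred (subst₂ _<_ (cong suc (toℕ-↑ˡ i p)) (cong suc (toℕ-↑ˡ j p)) lt))
      (λ lt → subst₂ _<_ (sym (cong suc (toℕ-↑ˡ i p))) (sym (cong suc (toℕ-↑ˡ j p))) (s≤s lt))

    -- The apex has the smallest label, so every edge at it is counted from this end.
    edges-at-apex : sumOver (edge? apex) (weight apex) ≡
                    (∑[ j < N ] (p + 1 + count (nonadjacent? j))) + p * (N + p)
    edges-at-apex = sumOver-vertices (edge? apex) (weight apex)
      refl toBase toPendant
      where
      toBase : sumOver (edge? apex ∘ base) (weight apex ∘ base) ≡
               ∑[ j < N ] (p + 1 + count (nonadjacent? j))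
      toBase = trans
        (sumOver-all (edge? apex ∘ base) (weight apex ∘ base) λ j → s≤s z≤n , apex~base j)
        (sum-cong-≗ λ j → trans (weight-apex (base j) λ ()) (n₁-apex-base j))
      toPendant : sumOver (edge? apex ∘ pendant) (weight apex ∘ pendant) ≡ p * (N + p)
      toPendant = trans
        (sumOver-all (edge? apex ∘ pendant) (weight apex ∘ pendant) λ l → s≤s z≤n , apex~pendant l)
        (trans (sum-cong-≗ λ l → trans (weight-apex (pendant l) λ ()) (n₁-apex-pendant l))
               (∑-const p (N + p)))

    edgeG? : ∀ i j → Dec (i <ᶠ j × i G.~ j)
    edgeG? i j = (i <ᶠ? j) ×-dec (i G.~? j)

    weightG : Fin N → Fin N → ℕ
    weightG i j = n₁ G connG i j * n₂ G connG i j

    edges-at-base : ∀ i → sumOver (edge? (base i)) (weight (base i)) ≡ sumOver (edgeG? i) (weightG i)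
    edges-at-base i = begin
      sumOver (edge? (base i)) (weight (base i))
        ≡⟨ sumOver-vertices (edge? (base i)) (weight (base i))
             refl toBase toPendant ⟩
      sumOver (edgeG? i) (weightG i) + 0
        ≡⟨ +-identityʳ _ ⟩
      sumOver (edgeG? i) (weightG i) ∎
      where
      open ≡-Reasoning
      toBase : sumOver (edge? (base i) ∘ base) (weight (base i) ∘ base) ≡ sumOver (edgeG? i) (weightG i)
      toBase = sumOver-cong (edge? (base i) ∘ base) (edgeG? i) (weight (base i) ∘ base) (weightG i)
        (λ j → mk⇔ (λ (lt , e) → to (base-monotone i j) lt , to (base-~ i j) e)
                   (λ (lt , e) → from (base-monotone i j) lt , from (base-~ i j) e))
        -- `n₂` of an edge is `n₁` of the reversed edge, so one lemma gives both factors.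
        λ j _ → cong₂ _*_ (n₁-base i j) (n₁-base j i)
      toPendant : sumOver (edge? (base i) ∘ pendant) (weight (base i) ∘ pendant) ≡ 0
      toPendant = sumOver-none (edge? (base i) ∘ pendant) (weight (base i) ∘ pendant)
        λ l e → base≁pendant (proj₂ e)

    -- The single edge at a pendant vertex leads to the smaller label `zero` and is counted there.
    edges-at-pendant : ∀ l → sumOver (edge? (pendant l)) (weight (pendant l)) ≡ 0
    edges-at-pendant l = sumOver-none (edge? (pendant l)) (weight (pendant l)) λ x (lt , e) →
      case subst (pendant l <ᶠ_) (pendant-~ l x (H.~-sym e)) lt of λ ()

  Sz-cone-with-pendants : Sz H connH ≡
    (∑[ j < N ] (p + 1 + count (λ k → ¬? (k ≟ᶠ j) ×-dec ¬? (k G.~? j)))) + p * (N + p) + Sz G connG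
  Sz-cone-with-pendants = trans
    (∑-vertices λ a → sumOver (edge? a) (weight a))
    (cong₂ _+_ edges-at-apex (trans
      (cong₂ _+_ (sum-cong-≗ edges-at-base)
                 (trans (sum-cong-≗ edges-at-pendant) (sum-replicate-zero p)))
      (+-identityʳ _)))

-- Orders of elements in ℤ/n

-- Passing to cofactors reverses divisibility: with `c = k * a`, cancelling `a` leaves `b = k * d`.
cofactor-∣ : ∀ {a b c d} .{{_ : NonZero a}} → a * b ≡ c * d → a ∣ c → d ∣ b
cofactor-∣ {a} {b} {c} {d} eq (divides k c≡ka) = divides k (*-cancelˡ-≡ b (k * d) a (begin
  a * b         ≡⟨ eq ⟩
  c * d         ≡⟨ cong (_* d) c≡ka ⟩
  k * a * d     ≡⟨ rearrange k a d ⟩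
  a * (k * d)   ∎))
  where
  open ≡-Reasoning
  rearrange : ∀ k a d → k * a * d ≡ a * (k * d)
  rearrange = solve-∀

module _ (n : ℕ) .{{_ : NonZero n}} where

  -- The order of x in ℤ/n.
  ord : ℕ → ℕ
  ord x = quotient (gcd[m,n]∣n x n)

  ord*gcd : ∀ x → n ≡ ord x * gcd x n
  ord*gcd x = _∣_.equality (gcd[m,n]∣n x n)

  ord∣n : ∀ x → ord x ∣ n
  ord∣n x = divides (gcd x n) (trans (ord*gcd x) (*-comm (ord x) (gcd x n)))

  private
    gcd-nonZero : ∀ x → NonZero (gcd x n)
    gcd-nonZero x = ≢-nonZero (gcd[m,n]≢0 x n (inj₂ (≢-nonZero⁻¹ n)))

    ord-nonZero : ∀ x → NonZero (ord x)
    ord-nonZero x = ≢-nonZero λ eq → ≢-nonZero⁻¹ n (trans (ord*gcd x) (cong (_* gcd x n) eq))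

  ord-unique : ∀ {x e} → n ≡ e * gcd x n → ord x ≡ e
  ord-unique {x} {e} eq = *-cancelʳ-≡ (ord x) e (gcd x n) {{gcd-nonZero x}} (trans (sym (ord*gcd x)) eq)

  ord∣ord⇔gcd∣gcd : ∀ u v → ord u ∣ ord v ⇔ gcd v n ∣ gcd u n
  ord∣ord⇔gcd∣gcd u v = mk⇔
    (cofactor-∣ {{ord-nonZero u}} (trans (sym (ord*gcd u)) (ord*gcd v)))
    (cofactor-∣ {{gcd-nonZero v}} (trans (trans (*-comm (gcd v n) (ord v)) (sym (ord*gcd v)))
                                         (trans (ord*gcd u) (*-comm (ord u) (gcd u n)))))

  -- Bézout gives a multiple of `v` congruent to `gcd v n`; scaling it by `c = u / gcd v n` reaches
  -- `u`. Over ℕ the identity has two cases, according to which coefficient is negative.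
  multiple-mod : ∀ v u → gcd v n ∣ u → ∃ λ m → (m * v) % n ≡ u % n
  multiple-mod v u (divides c u≡cg) with Bézout.identity (gcd-GCD v n)
  ... | Bézout.+- x y eq = c * x , (begin
    (c * x * v) % n               ≡⟨ cong (_% n) (begin
      c * x * v                     ≡⟨ *-assoc c x v ⟩
      c * (x * v)                   ≡⟨ cong (c *_) eq ⟨
      c * (gcd v n + y * n)         ≡⟨ expand c (gcd v n) y n ⟩
      c * gcd v n + c * y * n       ≡⟨ cong (_+ c * y * n) u≡cg ⟨
      u + c * y * n                 ∎) ⟩
    (u + c * y * n) % n           ≡⟨ [m+kn]%n≡m%n u (c * y) n ⟩
    u % n                         ∎)
    where
    open ≡-Reasoning
    expand : ∀ c g y n → c * (g + y * n) ≡ c * g + c * y * n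
    expand = solve-∀
  -- Here −x is the Bézout coefficient of v; (n − 1)x represents it modulo n.
  ... | Bézout.-+ x y eq = c * x * (n ∸ 1) , (begin
    (c * x * (n ∸ 1) * v) % n                  ≡⟨ [m+kn]%n≡m%n _ (c * y) n ⟨
    (c * x * (n ∸ 1) * v + c * y * n) % n      ≡⟨ cong (_% n) (begin
      c * x * (n ∸ 1) * v + c * y * n            ≡⟨ cong (c * x * (n ∸ 1) * v +_) (*-assoc c y n) ⟩
      c * x * (n ∸ 1) * v + c * (y * n)          ≡⟨ cong (λ z → c * x * (n ∸ 1) * v + c * z) eq ⟨
      c * x * (n ∸ 1) * v + c * (gcd v n + x * v) ≡⟨ expand c x (n ∸ 1) v (gcd v n) ⟩
      c * gcd v n + c * x * v * (1 + (n ∸ 1))    ≡⟨ cong₂ (λ z w → z + c * x * v * w) (sym u≡cg) (m+[n∸m]≡n (>-nonZero⁻¹ n)) ⟩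
      u + c * x * v * n                          ∎) ⟩
    (u + c * x * v * n) % n                    ≡⟨ [m+kn]%n≡m%n u (c * x * v) n ⟩
    u % n                                      ∎)
    where
    open ≡-Reasoning
    expand : ∀ c x k v g → c * x * k * v + c * (g + x * v) ≡ c * g + c * x * v * (1 + k)
    expand = solve-∀

  private module Z = FiniteGroup (ℤ/ n)

  ⊗-mod : ∀ m v → m Z.⊗ v ≡ (m * toℕ v) mod n
  ⊗-mod zero    v = refl
  ⊗-mod (suc m) v = trans
    (cong₂ (_⊕_ n) (sym (mod-toℕ n v)) (⊗-mod m v))
    (sym (mod-homo-+ n (toℕ v) (m * toℕ v)))

  toℕ-⊗ : ∀ m v → toℕ (m Z.⊗ v) ≡ (m * toℕ v) % n
  toℕ-⊗ m v = trans (cong toℕ (⊗-mod m v)) (toℕ-fromℕ< (m%n<n (m * toℕ v) n))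

  -- Both sides amount to `gcd v n` dividing `gcd u n`: the multiples of `v` modulo `n` are the
  -- multiples of that gcd.
  isPowerOf⇔ord∣ord : ∀ u v → Z.IsPowerOf u v ⇔ ord (toℕ u) ∣ ord (toℕ v)
  isPowerOf⇔ord∣ord u v = mk⇔ ⇒ ⇐
    where
    ⇒ : Z.IsPowerOf u v → ord (toℕ u) ∣ ord (toℕ v)
    ⇒ (m , u≡mv) = from (ord∣ord⇔gcd∣gcd (toℕ u) (toℕ v)) (gcd-greatest
      (subst (gcd (toℕ v) n ∣_) (sym (trans (cong toℕ u≡mv) (toℕ-⊗ m v)))
        -- Reduction modulo `n` keeps divisibility by `gcd v n`, which divides `n`.
        (%-presˡ-∣ (∣n⇒∣m*n m (gcd[m,n]∣m (toℕ v) n)) (gcd[m,n]∣n (toℕ v) n)))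
      (gcd[m,n]∣n (toℕ v) n))
    ⇐ : ord (toℕ u) ∣ ord (toℕ v) → Z.IsPowerOf u v
    ⇐ ord∣ord =
      let (m , eq) = multiple-mod (toℕ v) (toℕ u)
                       (∣-trans (to (ord∣ord⇔gcd∣gcd (toℕ u) (toℕ v)) ord∣ord) (gcd[m,n]∣m (toℕ u) n))
      in m , toℕ-injective (sym (trans (toℕ-⊗ m v) (trans eq (m<n⇒m%n≡m (toℕ<n u)))))

module _ (N : ℕ) where

  private
    n = suc N

  -- Order 1 would make the gcd equal to `n`, so `n` would divide the smaller positive number
  -- `suc (toℕ j)`.
  ord≢1 : ∀ (j : Fin N) → ord n (suc (toℕ j)) ≢ 1
  ord≢1 j eq = <⇒≱ (s≤s (toℕ<n j)) (∣⇒≤ (subst (_∣ suc (toℕ j)) gcd≡n (gcd[m,n]∣m (suc (toℕ j)) n)))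
    where
    gcd≡n : gcd (suc (toℕ j)) n ≡ n
    gcd≡n = sym (trans (ord*gcd n (suc (toℕ j))) (trans (cong (_* gcd (suc (toℕ j)) n) eq) (*-identityˡ _)))

  -- The elements of order e are the multiples k q with q = n / e and k coprime to e.
  count-ord : ∀ e → e ∣ n → e ≢ 1 → count {N} (λ j → ord n (suc (toℕ j)) ≟ e) ≡ φ e
  count-ord zero        e∣n                   e≢1 = contradiction (0∣⇒≡0 e∣n) λ ()
  count-ord e@(suc e-1) (divides q@(suc q-1) n≡qe) e≢1 = count-bijection R?
    (λ j → ord n (suc (toℕ j)) ≟ e) (λ k → coprime? (suc (toℕ k)) e)
    (λ r → R⇒ord r , proj₁ r) total functional surjective injective
    where
    open ≡-Reasoning
    R : Fin N → Fin e → Set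
    R j k = Coprime (suc (toℕ k)) e × suc (toℕ j) ≡ suc (toℕ k) * q
    R? : ∀ j k → Dec (R j k)
    R? j k = coprime? (suc (toℕ k)) e ×-dec (suc (toℕ j) ≟ suc (toℕ k) * q)
    gcd-scale : ∀ c → gcd (c * q) n ≡ q * gcd c e
    gcd-scale c = sym (trans (c*gcd[m,n]≡gcd[cm,cn] q c e) (cong₂ gcd (*-comm q c) (sym n≡qe)))
    R⇒ord : ∀ {j k} → R j k → ord n (suc (toℕ j)) ≡ e
    R⇒ord {j} {k} (coprime , eq) = ord-unique n {suc (toℕ j)} (begin
      n                         ≡⟨ n≡qe ⟩
      q * e                     ≡⟨ *-comm q e ⟩
      e * q                     ≡⟨ cong (e *_) (*-identityʳ q) ⟨
      e * (q * 1)               ≡⟨ cong (λ z → e * (q * z)) (coprime⇒gcd≡1 coprime) ⟨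
      e * (q * gcd (suc (toℕ k)) e) ≡⟨ cong (e *_) (gcd-scale (suc (toℕ k))) ⟨
      e * gcd (suc (toℕ k) * q) n   ≡⟨ cong (λ z → e * gcd z n) eq ⟨
      e * gcd (suc (toℕ j)) n       ∎)
    total : ∀ {j} → ord n (suc (toℕ j)) ≡ e → ∃ (R j)
    total {j} ord≡e = preimage (gcd[m,n]∣m (suc (toℕ j)) n)
      where
      gcd≡q : gcd (suc (toℕ j)) n ≡ q
      gcd≡q = *-cancelˡ-≡ _ _ e (begin
        e * gcd (suc (toℕ j)) n                       ≡⟨ cong (_* gcd (suc (toℕ j)) n) ord≡e ⟨
        ord n (suc (toℕ j)) * gcd (suc (toℕ j)) n     ≡⟨ ord*gcd n (suc (toℕ j)) ⟨
        n                                             ≡⟨ n≡qe ⟩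
        q * e                                         ≡⟨ *-comm q e ⟩
        e * q                                         ∎)
      preimage : gcd (suc (toℕ j)) n ∣ suc (toℕ j) → ∃ (R j)
      -- The witness is the quotient of the element by its gcd `q`; it is positive because the
      -- element is.
      preimage (divides (suc c) eq) = fromℕ< c<e ,
        (subst (λ z → Coprime (suc z) e) (sym (toℕ-fromℕ< c<e)) (gcd≡1⇒coprime gcd≡1)) ,
        trans eq′ (cong (λ z → suc z * q) (sym (toℕ-fromℕ< c<e)))
        where
        eq′ : suc (toℕ j) ≡ suc c * q
        eq′ = trans eq (cong (suc c *_) gcd≡q)
        c<e : c < e
        c<e = <-trans (n<1+n c) (*-cancelʳ-< q (suc c) e
          (subst₂ _<_ eq′ (trans n≡qe (*-comm q e)) (s≤s (toℕ<n j))))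
        gcd≡1 : gcd (suc c) e ≡ 1
        gcd≡1 = *-cancelˡ-≡ _ _ q (begin
          q * gcd (suc c) e           ≡⟨ gcd-scale (suc c) ⟨
          gcd (suc c * q) n           ≡⟨ cong (λ z → gcd z n) eq′ ⟨
          gcd (suc (toℕ j)) n         ≡⟨ gcd≡q ⟩
          q                           ≡⟨ *-identityʳ q ⟨
          q * 1                       ∎)
    functional : ∀ {j k l} → R j k → R j l → k ≡ l
    functional (_ , eq) (_ , eq′) =
      toℕ-injective (ℕ.suc-injective (*-cancelʳ-≡ _ _ q (trans (sym eq) eq′)))
    surjective : ∀ {k} → Coprime (suc (toℕ k)) e → ∃ λ j → R j k
    surjective {k} coprime = fromℕ< j<N , coprime , cong suc (toℕ-fromℕ< j<N)
      where
      suck<e : suc (toℕ k) < e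
      -- `φ` counts up to `e` inclusive. The value `e` would be coprime to itself, hence 1, and its
      -- multiple `e * q = n` would be the deleted zero.
      suck<e = ≤∧≢⇒< (toℕ<n k) λ eq → e≢1 (coprime (subst (e ∣_) (sym eq) ∣-refl , ∣-refl))
      -- The label is one less than the element `suc (toℕ k) * q`.
      j<N : q-1 + toℕ k * q < N
      j<N = ≤-pred (subst (suc (toℕ k) * q <_) (trans (*-comm e q) (sym n≡qe)) (*-monoˡ-< q suck<e))
    injective : ∀ {i j k} → R i k → R j k → i ≡ j
    injective (_ , eq) (_ , eq′) = toℕ-injective (ℕ.suc-injective (trans eq (sym eq′)))

-- Power graphs of ℤ/n and 𝔻 n

identity-dominating : ∀ G → Dominating (𝒫 G) (FiniteGroup.index G (FiniteGroup.ε G))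
identity-dominating G a a≢c = a≢c , inj₂ (0 , element-index G (FiniteGroup.ε G))

-- Once 0 is deleted, vertex `zero` stands for the residue 1, of which every element is a multiple.
generator-dominating : ∀ M → Dominating (𝒫* (ℤ/ suc (suc M))) zero
generator-dominating M a a≢0 = (a≢0 ∘ suc-injective) , inj₁ (toℕ (suc a) ,
  sym (trans (multiple-of-one n (toℕ (suc a))) (mod-toℕ n (suc a))))
  where n = suc (suc M)

-- Vertex `j` stands for the residue `suc j`. Equal vertices have equal, hence comparable, orders,
-- so incomparability also yields distinctness.
nonadjacent⇔ord≁ord : ∀ N (j k : Fin N) →
  (k ≢ j × ¬ Graph._~_ (𝒫* (ℤ/ suc N)) k j) ⇔ (¬ ord (suc N) (suc (toℕ k)) ∼ ord (suc N) (suc (toℕ j)))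
nonadjacent⇔ord≁ord N j k = mk⇔
  (λ (k≢j , k≁j) comparable → k≁j ((k≢j ∘ suc-injective) ,
     Sum.map (from (power (suc k) (suc j))) (from (power (suc j) (suc k))) comparable))
  (λ incomparable → (λ k≡j → incomparable (inj₁ (∣-reflexive (cong (λ z → ord (suc N) (suc (toℕ z))) k≡j)))) ,
     (λ (_ , p) → incomparable (Sum.map (to (power (suc k) (suc j))) (to (power (suc j) (suc k))) p)))
  where power = isPowerOf⇔ord∣ord (suc N)

module _ (n : ℕ) .{{_ : NonZero n}} where
  private
    module D = FiniteGroup (𝔻 n)
    module Z = FiniteGroup (ℤ/ n)

  ⊗-rotation : ∀ m i → m D.⊗ (r^ i) ≡ r^ (m Z.⊗ i)
  ⊗-rotation zero    i = refl
  ⊗-rotation (suc m) i = cong (D._∙_ (r^ i)) (⊗-rotation m i)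

  -- A reflection is an involution, so its powers alternate between the identity and itself.
  ⊗-reflection : ∀ m i → m D.⊗ (sr^ i) ≡ D.ε ⊎ m D.⊗ (sr^ i) ≡ sr^ i
  ⊗-reflection zero    i = inj₁ refl
  ⊗-reflection (suc m) i = case ⊗-reflection m i of λ
    { (inj₁ eq) → inj₂ (trans (cong (D._∙_ (sr^ i)) eq) (D.identityʳ (sr^ i)))
    ; (inj₂ eq) → inj₁ (trans (cong (D._∙_ (sr^ i)) eq) (D.inverseˡ (sr^ i)))
    }

  -- The enumeration lists the rotations first, so `i ↑ˡ n` is the label of `r^ i`, and powers of
  -- rotations are computed in ℤ/n.
  isPowerOf-rotation : ∀ i j → D.IsPowerOf (D.element (i ↑ˡ n)) (D.element (j ↑ˡ n)) ⇔ Z.IsPowerOf i j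
  isPowerOf-rotation i j rewrite splitAt-↑ˡ n i n | splitAt-↑ˡ n j n = mk⇔
    (λ (m , eq) → m , inj₁-injective (trans eq (⊗-rotation m j)))
    (λ (m , eq) → m , trans (cong inj₁ eq) (sym (⊗-rotation m j)))

  rotations-~ : ∀ i j → Graph._~_ (𝒫 (𝔻 n)) (i ↑ˡ n) (j ↑ˡ n) ⇔ Graph._~_ (𝒫 (ℤ/ n)) i j
  rotations-~ i j = mk⇔
    (λ (i≢j , p) → (i≢j ∘ cong (_↑ˡ n)) , Sum.map (to (isPowerOf-rotation i j)) (to (isPowerOf-rotation j i)) p)
    (λ (i≢j , p) → (i≢j ∘ ↑ˡ-injective n i j) ,
                   Sum.map (from (isPowerOf-rotation i j)) (from (isPowerOf-rotation j i)) p)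

  -- The powers of a reflection are itself and the identity, and it is a power of nothing but
  -- itself.
  reflection-~ : ∀ l x → Graph._~_ (𝒫 (𝔻 n)) x (n ↑ʳ l) → x ≡ D.index D.ε
  reflection-~ l x (x≢l , p) = case p of λ
    { (inj₁ (m , eq)) → case ⊗-reflection m l of λ
      { (inj₁ mx≡ε) → element⇒index (trans (reflect m eq) mx≡ε)
      ; (inj₂ mx≡l) → contradiction (element⇒index (trans (reflect m eq) mx≡l)) x≢l
      }
    ; (inj₂ (m , eq)) → contradiction (element⇒index (power m _ (trans (sym (splitAt-↑ʳ n n l)) eq))) x≢l
    }
    where
    reflect : ∀ m → D.element x ≡ m D.⊗ D.element (n ↑ʳ l) → D.element x ≡ m D.⊗ (sr^ l)
    reflect m eq = trans eq (cong (m D.⊗_) (splitAt-↑ʳ n n l))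
    element⇒index : ∀ {y} → D.element x ≡ y → x ≡ D.index y
    element⇒index eq = trans (sym (Inverse.strictlyInverseʳ D.enumeration x)) (cong D.index eq)
    power : ∀ m y → (sr^ l) ≡ m D.⊗ y → y ≡ (sr^ l)
    power m (r^ i)  eq = case trans eq (⊗-rotation m i) of λ ()
    power m (sr^ i) eq = case ⊗-reflection m i of λ
      { (inj₁ eq′) → case trans eq eq′ of λ ()
      ; (inj₂ eq′) → sym (trans eq eq′)
      }

-- Grouping elements by order, and the final formula.

strictlyMonotone⇒injective : ∀ {D} (d : Fin D → ℕ) → (∀ i j → i <ᶠ j → d i < d j) →
                             ∀ {i j} → d i ≡ d j → i ≡ j
strictlyMonotone⇒injective d mono {i} {j} eq with <ᶠ-cmp i j
... | tri< i<j _ _ = contradiction (mono i j i<j) (<-irrefl eq)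
... | tri≈ _ i≡j _ = i≡j
... | tri> _ _ j<i = contradiction (mono j i j<i) (<-irrefl (sym eq))

module _ (N : ℕ) (1<n : 1 < suc N) (D : ℕ) (d : Fin D → ℕ)
  (d-mono : ∀ i j → i <ᶠ j → d i < d j)
  (d-proper : ∀ m → ProperDivisor m (suc N) ⇔ ∃ λ i → d i ≡ m)
  where

  private
    n = suc N

    proper : ∀ i → ProperDivisor (d i) n
    proper i = from (d-proper (d i)) (i , refl)

    key : Fin N → ℕ
    key j = ord n (suc (toℕ j))

    -- The possible orders of nonzero elements; `n` comes first so that the generators split off as
    -- the leading term.
    divisors : Fin (suc D) → ℕ
    divisors zero    = n
    divisors (suc i) = d i

    divisors-injective : ∀ {i j} → divisors i ≡ divisors j → i ≡ j
    divisors-injective {zero}  {zero}  _  = refl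
    divisors-injective {zero}  {suc j} eq = contradiction (sym eq) (proj₂ (proj₂ (proper j)))
    divisors-injective {suc i} {zero}  eq = contradiction eq (proj₂ (proj₂ (proper i)))
    divisors-injective {suc i} {suc j} eq = cong suc (strictlyMonotone⇒injective d d-mono eq)

    divisors-cover : ∀ j → ∃ λ i → key j ≡ divisors i
    divisors-cover j = case key j ≟ n of λ
      { (yes eq) → zero , eq
      ; (no ≢n)  → let (i , eq) = to (d-proper (key j)) (ord∣n n (suc (toℕ j)) , ord≢1 N j , ≢n)
                   in suc i , sym eq
      }

    count-key : ∀ i → count (λ j → key j ≟ divisors i) ≡ φ (divisors i)
    count-key zero    = count-ord N n ∣-refl λ eq → <-irrefl (sym eq) 1<n
    count-key (suc i) = count-ord N (d i) (proj₁ (proper i)) (proj₁ (proj₂ (proper i)))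

  ∑-ord : (h : ℕ → ℕ) → ∑[ j < N ] h (ord n (suc (toℕ j))) ≡ h n * φ n + ∑[ i < D ] (h (d i) * φ (d i))
  ∑-ord h = trans (∑-fibres key divisors divisors-injective divisors-cover h)
                  (sum-cong-≗ λ i → cong (h (divisors i) *_) (count-key i))

  -- This is `∑-ord` for the indicator of incomparability with `o`; the generators contribute
  -- nothing because `o` divides `n`.
  count-incomparable : ∀ o → o ∣ n →
    count {N} (λ k → ¬? (ord n (suc (toℕ k)) ∼? o)) ≡ sumOver (λ k → ¬? (d k ∼? o)) (φ ∘ d)
  count-incomparable o o∣n = begin
    count {N} (λ k → ¬? (ord n (suc (toℕ k)) ∼? o))
      ≡⟨ ∑-ord if¬ ⟩
    if¬ n * φ n + (∑[ i < D ] (if¬ (d i) * φ (d i)))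
      ≡⟨ cong (λ z → z * φ n + (∑[ i < D ] (if¬ (d i) * φ (d i)))) if¬-n ⟩
    (∑[ i < D ] (if¬ (d i) * φ (d i)))
      ≡⟨ sum-cong-≗ (λ i → indicator (does (¬? (d i ∼? o))) (φ (d i))) ⟩
    sumOver (λ k → ¬? (d k ∼? o)) (φ ∘ d) ∎
    where
    open ≡-Reasoning
    if¬ : ℕ → ℕ
    if¬ e = if does (¬? (e ∼? o)) then 1 else 0
    if¬-n : if¬ n ≡ 0
    if¬-n = if-no (¬? (n ∼? o)) λ n≁o → n≁o (inj₂ o∣n)
    indicator : ∀ b x → (if b then 1 else 0) * x ≡ (if b then x else 0)
    indicator true  x = +-identityʳ x
    indicator false x = refl

  private
    -- For the order `o` of a nonzero rotation, this is `n₁` of the edge from the identity to that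
    -- rotation.
    incomparable : ℕ → ℕ
    incomparable o = n + 1 + sumOver (λ k → ¬? (d k ∼? o)) (φ ∘ d)

    incomparable-n : incomparable n ≡ n + 1
    incomparable-n = trans
      (cong (n + 1 +_) (sumOver-none (λ k → ¬? (d k ∼? n)) (φ ∘ d) λ k ≁ → ≁ (inj₁ (proj₁ (proper k)))))
      (+-identityʳ (n + 1))

    -- A divisor is comparable with itself, so both sums run over the same `k`.
    incomparable-d : ∀ i → incomparable (d i) ≡
      n + 1 + sumOver (λ k → ¬? (k ≟ᶠ i) ×-dec ¬? (d k ∼? d i)) (λ k → φ (d k))
    incomparable-d i = cong (n + 1 +_) (sumOver-cong
      (λ k → ¬? (d k ∼? d i)) (λ k → ¬? (k ≟ᶠ i) ×-dec ¬? (d k ∼? d i)) (φ ∘ d) (φ ∘ d)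
      (λ k → mk⇔ (λ ≁ → (λ k≡i → ≁ (inj₁ (∣-reflexive (cong d k≡i)))) , ≁) proj₂)
      λ _ _ → refl)

  -- Through incomparability of orders the summand depends only on the order of `j`, so `∑-ord`
  -- applies to it.
  ∑-nonadjacent : .{{nz : NonZero n}} → let G = 𝒫* (ℤ/_ n {{nz}}) in
    ∑[ j < N ] (n + 1 + count (λ k → ¬? (k ≟ᶠ j) ×-dec ¬? (Graph._~?_ G k j))) ≡
    (n + 1) * φ n +
    ∑[ i < D ] ((n + 1 + sumOver (λ k → ¬? (k ≟ᶠ i) ×-dec ¬? (d k ∼? d i)) (λ k → φ (d k))) * φ (d i))
  ∑-nonadjacent {{nz}} = trans
    (sum-cong-≗ λ j → cong (n + 1 +_) (trans
      (count-cong (λ k → ¬? (k ≟ᶠ j) ×-dec ¬? (Graph._~?_ (𝒫* (ℤ/_ n {{nz}})) k j))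
                  (λ k → ¬? (key k ∼? key j)) (nonadjacent⇔ord≁ord N j))
      (count-incomparable (key j) (ord∣n n (suc (toℕ j))))))
    (trans (∑-ord incomparable) (cong₂ _+_ (cong (_* φ n) incomparable-n)
      (sum-cong-≗ λ i → cong (_* φ (d i)) (incomparable-d i))))

-- The instance argument nz is passed explicitly because unifying two different
-- proofs of NonZero inside Sz makes Agda unfold both graphs.
Sz-𝔻 : ∀ M .{{nz : NonZero (suc (suc M))}} → let N = suc M; n = suc N in
  Sz (𝒫 (𝔻_ n {{nz}})) (𝒫-connected (𝔻_ n {{nz}})) ≡
  (∑[ j < N ] (n + 1 + count (λ k → ¬? (k ≟ᶠ j) ×-dec ¬? (Graph._~?_ (𝒫* (ℤ/_ n {{nz}})) k j))))
  + n * (N + n) + Sz (𝒫* (ℤ/_ n {{nz}})) (𝒫*-ℤ/-connected n {{nz}})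
Sz-𝔻 M {{nz}} = Sz-cone-with-pendants
  (𝒫* (ℤ/_ n {{nz}})) (𝒫*-ℤ/-connected n {{nz}}) (generator-dominating M)
  (𝒫 (𝔻_ n {{nz}})) (𝒫-connected (𝔻_ n {{nz}})) (identity-dominating (𝔻_ n {{nz}}))
  -- Deleting 0 shifts labels by one, so base vertex `i` is the rotation with exponent `suc i`.
  (λ i j → mk⇔ (λ e → to (rotations-~ n {{nz}} (suc i) (suc j)) e)
               (λ e → from (rotations-~ n {{nz}} (suc i) (suc j)) e))
  (reflection-~ n {{nz}})
  where n = suc (suc M)

-- Stated for variables, so that no sum is unfolded when it is applied.
regroup : ∀ N f s z {w t} → w ≡ (suc N + 1) * f + s → t ≡ w + suc N * (N + suc N) + z →
          t ≡ z + s + suc N * (2 * suc N ∸ 1 + f) + f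
regroup N f s z refl refl = expand N f s z
  where
  expand : ∀ N f s z → (suc N + 1) * f + s + suc N * (N + suc N) + z ≡
                       z + s + suc N * (N + (suc N + 0) + f) + f
  expand = solve-∀

theorem3p3 : (n : ℕ) .{{_ : NonZero n}} → 2 < n →
    (D : ℕ) (d : Fin D → ℕ) →
    (∀ i j → i <ᶠ j → d i < d j) →
    (∀ m → ProperDivisor m n ⇔ ∃ λ i → d i ≡ m) →
    Sz (𝒫 (𝔻 n)) (𝒫-connected (𝔻 n)) ≡
    Sz (𝒫* (ℤ/ n)) (𝒫*-ℤ/-connected n)
    + (∑[ i < D ] ((n + 1 + sumOver (λ k → ¬? (k ≟ᶠ i) ×-dec ¬? (d k ∼? d i)) (λ k → φ (d k))) * φ (d i)))
    + n * (2 * n ∸ 1 + φ n)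
    + φ n
theorem3p3 (suc zero) {{_}} (s≤s ())
theorem3p3 n@(suc N@(suc M)) {{nz}} 2<n D d d-mono d-proper =
  -- The edges to reflections give `n * (N + n)`, that is `n * (2 * n ∸ 1)`; those to generators
  -- give `(n + 1) * φ n`, split into `n * φ n` and `φ n`.
  regroup N (φ n) _ (Sz (𝒫* (ℤ/_ n {{nz}})) (𝒫*-ℤ/-connected n {{nz}}))
    (∑-nonadjacent N (<⇒≤ 2<n) D d d-mono d-proper {{nz}}) (Sz-𝔻 M {{nz}})
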